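{- Let $F\in\mathcal{T}^N_3$ satisfy $P^N(F)=\sup_{E\in\mathcal{T}^N_3}P^N(E)$, and suppose that the associated sequence of $F$ is $(1,n_2,n_3,n_4,1)$ with $n_3>1$. Then $\max\{n_2,n_4\}\le 2$.
   Context: A trunk graph with $N>0$ edges is a directed graph with vertices $v_1,\dots,v_n$ ($n\ge2$) such that every edge goes from some $v_i$ to $v_{i+1}$, there are $m_i\ge1$ edges from $v_i$ to $v_{i+1}$ for each $1\le i\le n-1$, and $m_1+\dots+m_{n-1}=N$. $\mathcal{T}^N_3$ is the set of trunk graphs with $N$ edges and all $m_i\le3$. $P^N(E)$ is the number of all finite directed paths in $E$, where vertices count as paths of length $0$. A trunk graph has associated sequence $(n_1,n_2,n_3,n_4,n_5)$ (with $n_j\ge0$) if $(m_1,\dots,m_{n-1})$ consists of $n_1$ ones, followed by $n_2$ twos, then $n_3$ threes, then $n_4$ twos, then $n_5$ ones. -}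

module Defs where

open import Data.Fin using (Fin; zero; suc; inject₁)
open import Data.Fin.Properties using (1↔⊤; +↔⊎; *↔×)
open import Data.List using (List; []; _∷_; _++_; length; lookup; replicate)
open import Data.List.Relation.Unary.All using (All)
open import Data.Nat using (ℕ; suc; _+_; _*_; _≤_)
open import Data.Nat.ListAction using (sum)
open import Data.Product using (∃-syntax; _×_; _,_; proj₁)
open import Data.Product.Function.NonDependent.Propositional using (_×-↔_)
open import Data.Sum using (_⊎_; inj₁; inj₂)
open import Data.Sum.Function.Propositional using (_⊎-↔_)
open import Data.Unit using (⊤; tt)
open import Function.Bundles using (_↔_; mk↔ₛ′; module Inverse)
open import Function.Construct.Composition using (_↔-∘_)
open import Function.Construct.Identity using (↔-id)
open import Function.Construct.Symmetry using (↔-sym)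
open import Relation.Binary.Construct.Closure.ReflexiveTransitive
  using (Star; ε; _◅_; gmap)
open import Relation.Binary.PropositionalEquality
  using (_≡_; refl; cong; subst)

-- The list (m₁, …, mₙ₋₁) determines the directed graph up to isomorphism.
-- The vertex vⱼ is the element j - 1 of Fin n, where n = suc (length ms).

Vertex : List ℕ → Set
Vertex ms = Fin (suc (length ms))

data Edge (ms : List ℕ) : Vertex ms → Vertex ms → Set where
  edge : (i : Fin (length ms)) → Fin (lookup ms i) → Edge ms (inject₁ i) (suc i)

-- ε : Star (Edge ms) u u is the path of length 0 at the vertex u.

PathFrom : (ms : List ℕ) → Vertex ms → Set
PathFrom ms u = ∃[ v ] Star (Edge ms) u v

Path : List ℕ → Set
Path ms = ∃[ u ] PathFrom ms u

record TrunkGraph (N : ℕ) : Set where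
  field
    multiplicities : List ℕ
    2≤#vertices    : 2 ≤ suc (length multiplicities)
    positive       : All (1 ≤_) multiplicities
    #edges≡N       : sum multiplicities ≡ N

open TrunkGraph public

-- Path ms is finite. This is needed only to define the number of paths as the
-- cardinality of the type of paths.

private
  shiftEdge : ∀ {m ms u v} → Edge ms u v → Edge (m ∷ ms) (suc u) (suc v)
  shiftEdge (edge i l) = edge (suc i) l

  shift : ∀ {m ms u} → PathFrom ms u → PathFrom (m ∷ ms) (suc u)
  shift (v , p) = suc v , gmap suc shiftEdge p

  unshift : ∀ {m ms x y u} → Star (Edge (m ∷ ms)) x y → x ≡ suc u → PathFrom ms u
  unshift {u = u} ε              refl = u , ε
  unshift (edge (suc i) l ◅ p) refl with unshift p refl
  ... | v , q = v , edge i l ◅ q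

  unshift-shift : ∀ {m ms u v} (p : Star (Edge ms) u v) →
    unshift {m} (gmap suc shiftEdge p) refl ≡ (v , p)
  unshift-shift ε = refl
  unshift-shift {m} (edge i l ◅ p) rewrite unshift-shift {m} p = refl

  shift-unshift : ∀ {m ms x y u} (p : Star (Edge (m ∷ ms)) x y) (eq : x ≡ suc u) →
    shift (unshift p eq) ≡ (y , subst (λ z → Star (Edge (m ∷ ms)) z y) eq p)
  shift-unshift ε refl = refl
  shift-unshift (edge (suc i) l ◅ p) refl
    with unshift p refl | shift-unshift p refl
  ... | v , q | refl = refl

  fromSuc : ∀ {m ms u} → PathFrom ms u ↔ PathFrom (m ∷ ms) (suc u)
  fromSuc = mk↔ₛ′ shift (λ { (_ , p) → unshift p refl })
    (λ { (_ , p) → shift-unshift p refl }) (λ { (_ , p) → unshift-shift p })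

  only-ε : ∀ {x y} (p : Star (Edge []) x y) (eq : x ≡ zero) →
    _≡_ {A = PathFrom [] zero} (zero , ε)
      (y , subst (λ z → Star (Edge []) z y) eq p)
  only-ε ε               refl = refl
  only-ε (edge () _ ◅ _) _

  fromLast : PathFrom [] zero ↔ ⊤
  fromLast = mk↔ₛ′ _ (λ _ → zero , ε) (λ _ → refl)
    (λ { (_ , p) → only-ε p refl })

  splitFirst : ∀ {m ms x y} → Star (Edge (m ∷ ms)) x y → x ≡ zero →
    ⊤ ⊎ (Fin m × PathFrom (m ∷ ms) (suc zero))
  splitFirst ε                     _ = inj₁ tt
  splitFirst {y = y} (edge zero l ◅ p) _ = inj₂ (l , y , p)

  joinFirst : ∀ {m ms} → ⊤ ⊎ (Fin m × PathFrom (m ∷ ms) (suc zero)) →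
    PathFrom (m ∷ ms) zero
  joinFirst (inj₁ tt)          = zero , ε
  joinFirst (inj₂ (l , y , p)) = y , edge zero l ◅ p

  join-split : ∀ {m ms x y} (p : Star (Edge (m ∷ ms)) x y) (eq : x ≡ zero) →
    joinFirst (splitFirst p eq) ≡
      (y , subst (λ z → Star (Edge (m ∷ ms)) z y) eq p)
  join-split ε                 refl = refl
  join-split (edge zero l ◅ p) refl = refl

  fromZero : ∀ {m ms} →
    PathFrom (m ∷ ms) zero ↔ (⊤ ⊎ (Fin m × PathFrom ms zero))
  fromZero = (↔-id _ ⊎-↔ (↔-id _ ×-↔ ↔-sym fromSuc)) ↔-∘
    mk↔ₛ′ (λ { (_ , p) → splitFirst p refl }) joinFirst
      (λ { (inj₁ tt) → refl ; (inj₂ _) → refl })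
      (λ { (_ , p) → join-split p refl })

  Path-∷ : ∀ {m ms} → Path (m ∷ ms) ↔ (PathFrom (m ∷ ms) zero ⊎ Path ms)
  Path-∷ = mk↔ₛ′
    (λ { (zero , p) → inj₁ p ; (suc u , p) → inj₂ (u , Inverse.from fromSuc p) })
    (λ { (inj₁ p) → zero , p ; (inj₂ (u , p)) → suc u , shift p })
    (λ { (inj₁ p) → refl
       ; (inj₂ (u , p)) → cong (λ q → inj₂ (u , q)) (Inverse.strictlyInverseʳ fromSuc p) })
    (λ { (zero , p) → refl
       ; (suc u , p) → cong (suc u ,_) (Inverse.strictlyInverseˡ fromSuc p) })

  Path-[] : Path [] ↔ ⊤
  Path-[] = fromLast ↔-∘
    mk↔ₛ′ (λ { (zero , p) → p ; (suc () , _) }) (zero ,_) (λ _ → refl)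
      (λ { (zero , p) → refl ; (suc () , _) })

pathsFromZero-finite : ∀ ms → ∃[ k ] (PathFrom ms zero ↔ Fin k)
pathsFromZero-finite [] = 1 , (↔-sym 1↔⊤ ↔-∘ fromLast)
pathsFromZero-finite (m ∷ ms) with pathsFromZero-finite ms
... | a , f = 1 + m * a ,
  (↔-sym +↔⊎ ↔-∘ ((↔-sym 1↔⊤ ⊎-↔ (↔-sym *↔× ↔-∘ (↔-id _ ×-↔ f))) ↔-∘ fromZero))

paths-finite : ∀ ms → ∃[ k ] (Path ms ↔ Fin k)
paths-finite [] = 1 , (↔-sym 1↔⊤ ↔-∘ Path-[])
paths-finite (m ∷ ms) with pathsFromZero-finite (m ∷ ms) | paths-finite ms
... | a , f | b , g = a + b , (↔-sym +↔⊎ ↔-∘ ((f ⊎-↔ g) ↔-∘ Path-∷))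

P : ∀ {N} → TrunkGraph N → ℕ
P E = proj₁ (paths-finite (multiplicities E))

𝒯₃ : (N : ℕ) → TrunkGraph N → Set
𝒯₃ N E = All (_≤ 3) (multiplicities E)

IsSupremum : {A : Set} → (A → Set) → (A → ℕ) → ℕ → Set
IsSupremum S f s =
  (∀ x → S x → f x ≤ s) × (∀ u → (∀ x → S x → f x ≤ u) → s ≤ u)

HasAssociatedSequence : ∀ {N} → TrunkGraph N → (n₁ n₂ n₃ n₄ n₅ : ℕ) → Set
HasAssociatedSequence E n₁ n₂ n₃ n₄ n₅ =
  multiplicities E ≡
    replicate n₁ 1 ++ replicate n₂ 2 ++ replicate n₃ 3 ++ replicate n₄ 2 ++ replicate n₅ 1

{-# OPTIONS --safe #-}

-- Write A = 2^a, B = 3^b, C = 2^c. The trunk graph with associated sequence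
-- (1, a, b, c, 1) has T paths, where
--   4 T = B (6 A - 1) (6 C - 1) + 6 A + 6 C - 4 a - 4 c - 2 b - 13.
-- This is symmetric in a and c. Let a ≥ 3 and b ≥ 2. If c ≤ 1, then T increases
-- when one 2 moves from the left block of twos to the right one. If c ≥ 2, then
-- T increases when two twos of the left block and one of the right block are
-- replaced by two threes.

module Submission where

open import Defs
open import Data.List using (List; []; _∷_; _++_; replicate)
open import Data.List.Relation.Unary.All using (All; []; _∷_)
open import Data.List.Relation.Unary.All.Properties using (++⁺; replicate⁺)
open import Data.Nat
open import Data.Nat.ListAction using (sum)
open import Data.Nat.ListAction.Properties using (sum-++)
open import Data.Nat.Properties
open import Data.Nat.Tactic.RingSolver using (solve-∀)
open import Data.Product using (_,_; proj₁)
open import Relation.Binary.PropositionalEquality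
open import Relation.Nullary using (contradiction)

-- Path counts of blocks of equal multiplicities

#pathsFromFirst : List ℕ → ℕ
#pathsFromFirst ms = proj₁ (pathsFromZero-finite ms)

#paths : List ℕ → ℕ
#paths ms = proj₁ (paths-finite ms)

-- Over ℕ there is no subtraction, so the ring identity L - R = l - r is checked in cross-added
-- form. A combination of known equations serves as `l ≡ r`; an equation with a negative coefficient
-- enters through `sym`.
linear-combination : ∀ {l r L R} → l ≡ r → L + r ≡ R + l → L ≡ R
linear-combination {l} {L = L} {R} refl eq = +-cancelʳ-≡ l L R eq

-- With m = 1 + k, the geometric series is summed after multiplication by k.
#pathsFromFirst-replicate : ∀ k n ms →
  k * #pathsFromFirst (replicate n (suc k) ++ ms) + 1 ≡
    suc k ^ n * (k * #pathsFromFirst ms + 1)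
#pathsFromFirst-replicate k zero    ms = sym (+-identityʳ _)
#pathsFromFirst-replicate k (suc n) ms =
  linear-combination (cong (suc k *_) (#pathsFromFirst-replicate k n ms))
    (identity k (#pathsFromFirst (replicate n (suc k) ++ ms)) (#pathsFromFirst ms)
      (suc k ^ n))
  where
  identity : ∀ k s′ s p →
    k * (1 + suc k * s′) + 1 + suc k * (p * (k * s + 1)) ≡
      suc k * p * (k * s + 1) + suc k * (k * s′ + 1)
  identity = solve-∀

-- Summing the previous formula over the n vertices that the block adds gives a second geometric
-- series, hence the second factor k. The 1 in each summand, times k, adds up to `k * n`.
#paths-replicate : ∀ k n ms →
  k * k * #paths (replicate n (suc k) ++ ms) + k * n
      + suc k * (k * #pathsFromFirst ms + 1) ≡
    k * k * #paths ms + suc k * suc k ^ n * (k * #pathsFromFirst ms + 1)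
#paths-replicate k zero    ms =
  identity k (#paths ms) (#pathsFromFirst ms)
  where
  identity : ∀ k t s →
    k * k * t + k * 0 + suc k * (k * s + 1) ≡ k * k * t + suc k * 1 * (k * s + 1)
  identity = solve-∀
#paths-replicate k (suc n) ms =
  linear-combination
    (cong₂ (λ x y → k * x + y) (#pathsFromFirst-replicate k (suc n) ms)
      (#paths-replicate k n ms))
    (identity k n (#pathsFromFirst (replicate n (suc k) ++ ms))
      (#paths (replicate n (suc k) ++ ms)) (#pathsFromFirst ms) (#paths ms)
      (suc k ^ n))
  where
  identity : ∀ k n s′ t′ s t p →
    k * k * (1 + suc k * s′ + t′) + k * suc n + suc k * (k * s + 1)
        + (k * (suc k * p * (k * s + 1)) + (k * k * t + suc k * p * (k * s + 1))) ≡
      k * k * t + suc k * (suc k * p) * (k * s + 1)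
        + (k * (k * (1 + suc k * s′) + 1)
          + (k * k * t′ + k * n + suc k * (k * s + 1)))
  identity = solve-∀

-- The closed formula for the number of paths

profile : ℕ → ℕ → ℕ → List ℕ
profile a b c =
  replicate 1 1 ++ replicate a 2 ++ replicate b 3 ++ replicate c 2 ++ replicate 1 1

-- The block formulas are composed, and all subtracted terms are moved to the left side. The final
-- `replicate 1 1` has 2 paths from its first vertex and 3 in all.
#paths-profile : ∀ a b c → let A = 2 ^ a; B = 3 ^ b; C = 2 ^ c in
  4 * #paths (profile a b c) + (4 * a + 4 * c + 2 * b + 13 + 6 * (A * B) + 6 * (B * C)) ≡
    36 * (A * B * C) + B + 6 * A + 6 * C
#paths-profile a b c =
  linear-combination
    -- The coefficients eliminate s₃, t₃, t₂, t₁, then s₂ with 6 A - 4 and s₁ with 12 A B - 2 B - 6.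
    -- The factor 4 is already present in `t₂-eq` as 2 * 2.
    (cong₂ _+_ (cong₂ _+_ (cong (4 *_) s₃-eq) (cong (4 *_) t₃-eq))
      (cong₂ _+_ (cong₂ _+_ t₂-eq (cong (4 *_) t₁-eq))
        (cong₂ _+_
          (cong₂ _+_ (cong (6 * A *_) s₂-eq) (cong (4 *_) (sym s₂-eq)))
          (cong₂ _+_ (cong (12 * (A * B) *_) s₁-eq)
            (cong ((2 * B + 6) *_) (sym s₁-eq))))))
    (identity a b c A B C (#pathsFromFirst R₁) (#pathsFromFirst R₂)
      (#pathsFromFirst R₃) (#paths R₁) (#paths R₂) (#paths R₃))
  where
  A = 2 ^ a
  B = 3 ^ b
  C = 2 ^ c
  R₁ = replicate c 2 ++ replicate 1 1
  R₂ = replicate b 3 ++ R₁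
  R₃ = replicate a 2 ++ R₂
  s₁-eq = #pathsFromFirst-replicate 1 c (replicate 1 1)
  s₂-eq = #pathsFromFirst-replicate 2 b R₁
  s₃-eq = #pathsFromFirst-replicate 1 a R₂
  t₁-eq = #paths-replicate 1 c (replicate 1 1)
  t₂-eq = #paths-replicate 2 b R₁
  t₃-eq = #paths-replicate 1 a R₂
  identity : ∀ a b c A B C s₁ s₂ s₃ t₁ t₂ t₃ →
    4 * (1 + 1 * s₃ + t₃) + (4 * a + 4 * c + 2 * b + 13 + 6 * (A * B) + 6 * (B * C))
      + (4 * (A * (1 * s₂ + 1)) + 4 * (1 * 1 * t₂ + 2 * A * (1 * s₂ + 1))
        + (2 * 2 * t₁ + 3 * B * (2 * s₁ + 1) + 4 * (1 * 1 * 3 + 2 * C * (1 * 2 + 1))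
          + (6 * A * (B * (2 * s₁ + 1)) + 4 * (2 * s₂ + 1)
            + (12 * (A * B) * (C * (1 * 2 + 1)) + (2 * B + 6) * (1 * s₁ + 1))))) ≡
    36 * (A * B * C) + B + 6 * A + 6 * C
      + (4 * (1 * s₃ + 1) + 4 * (1 * 1 * t₃ + 1 * a + 2 * (1 * s₂ + 1))
        + (2 * 2 * t₂ + 2 * b + 3 * (2 * s₁ + 1)
            + 4 * (1 * 1 * t₁ + 1 * c + 2 * (1 * 2 + 1))
          + (6 * A * (2 * s₂ + 1) + 4 * (B * (2 * s₁ + 1))
            + (12 * (A * B) * (1 * s₁ + 1) + (2 * B + 6) * (C * (1 * 2 + 1))))))
  identity = solve-∀

#paths-profile-comm : ∀ a b c → #paths (profile a b c) ≡ #paths (profile c b a)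
#paths-profile-comm a b c =
  *-cancelˡ-≡ _ _ 4 (linear-combination
    (cong₂ _+_ (#paths-profile a b c) (sym (#paths-profile c b a)))
    (identity a b c (2 ^ a) (3 ^ b) (2 ^ c) (#paths (profile a b c))
      (#paths (profile c b a))))
  where
  identity : ∀ a b c A B C x y →
    4 * x + (36 * (A * B * C) + B + 6 * A + 6 * C
      + (4 * y + (4 * c + 4 * a + 2 * b + 13 + 6 * (C * B) + 6 * (B * A)))) ≡
    4 * y + (4 * x + (4 * a + 4 * c + 2 * b + 13 + 6 * (A * B) + 6 * (B * C))
      + (36 * (C * B * A) + B + 6 * C + 6 * A))
  identity = solve-∀

-- Exchanges that increase the number of paths

excess⇒< : ∀ {x y X Y X′ Y′} d → 4 * x + X ≡ Y → 4 * y + X′ ≡ Y′ →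
  Y′ + X ≡ Y + X′ + suc d → x < y
excess⇒< {x} {y} {X} {X′ = X′} d refl refl eq =
  *-cancelˡ-< 4 x y (+-cancelʳ-< (X + X′) (4 * x) (4 * y)
    (subst₂ _<_ (+-assoc (4 * x) X X′) (rearrange (4 * y) X X′)
      (subst (4 * x + X + X′ <_) (sym eq) (m<m+n (4 * x + X + X′) z<s))))
  where
  rearrange : ∀ u v w → u + w + v ≡ u + (v + w)
  rearrange = solve-∀

-- The move keeps A C and a + c, so only the part -6 (B - 1) (A + C) of the formula changes, and A +
-- C shrinks as the two blocks become more equal.
balancing-increases-#paths : ∀ a b c → c < a → 1 ≤ b →
  #paths (profile (suc a) b c) < #paths (profile a b (suc c))
balancing-increases-#paths a b c c<a 1≤b =
  exchange a b c (2 ^ a) (3 ^ b) (2 ^ c) (^-monoʳ-< 2 (s≤s z<s) c<a)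
    (^-monoʳ-≤ 3 1≤b)
    (#paths-profile (suc a) b c) (#paths-profile a b (suc c))
  where
  -- The excess is 6 (A - C) (B - 1).
  identity : ∀ a b c p q C → let A = suc C + p; B = 3 + q in
    36 * (A * B * (2 * C)) + B + 6 * A + 6 * (2 * C)
      + (4 * suc a + 4 * c + 2 * b + 13 + 6 * (2 * A * B) + 6 * (B * C)) ≡
    36 * (2 * A * B * C) + B + 6 * (2 * A) + 6 * C
      + (4 * a + 4 * suc c + 2 * b + 13 + 6 * (A * B) + 6 * (B * (2 * C)))
      + suc (11 + 12 * p + 6 * q + 6 * (p * q))
  identity = solve-∀

  -- The powers become variables, so that matching on `refl` can replace them by a lower bound plus
  -- a remainder.
  exchange : ∀ a b c A B C {x y} → C < A → 3 ≤ B →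
    4 * x + (4 * suc a + 4 * c + 2 * b + 13 + 6 * (2 * A * B) + 6 * (B * C)) ≡
      36 * (2 * A * B * C) + B + 6 * (2 * A) + 6 * C →
    4 * y + (4 * a + 4 * suc c + 2 * b + 13 + 6 * (A * B) + 6 * (B * (2 * C))) ≡
      36 * (A * B * (2 * C)) + B + 6 * A + 6 * (2 * C) →
    x < y
  exchange a b c A B C C<A 3≤B x-eq y-eq
    with m≤n⇒∃[o]m+o≡n C<A | m≤n⇒∃[o]m+o≡n 3≤B
  ... | p , refl | q , refl = excess⇒< _ x-eq y-eq (identity a b c p q C)

-- Three twos and two threes use equally many edges, but 3 * 3 exceeds 2 * 2 * 2, so the leading
-- term grows from 288 A B C to 324 A B C. The lower terms work against this: the excess is 32 at A
-- = C = 2, B = 9, but would be -16 at A = C = 2, B = 3.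
trading-increases-#paths : ∀ a b c → 1 ≤ a → 2 ≤ b → 1 ≤ c →
  #paths (profile (2 + a) b (1 + c)) < #paths (profile a (2 + b) c)
trading-increases-#paths a b c 1≤a 2≤b 1≤c =
  exchange a b c (2 ^ a) (3 ^ b) (2 ^ c) (^-monoʳ-≤ 2 1≤a) (^-monoʳ-≤ 3 2≤b)
    (^-monoʳ-≤ 2 1≤c)
    (#paths-profile (2 + a) b (1 + c)) (#paths-profile a (2 + b) c)
  where
  -- The excess is B (36 A C - 30 A - 42 C + 8) - 18 A - 6 C + 8.
  identity : ∀ a b c p q r → let A = 2 + p; B = 9 + q; C = 2 + r in
    36 * (A * (3 * (3 * B)) * C) + 3 * (3 * B) + 6 * A + 6 * C
      + (4 * (2 + a) + 4 * (1 + c) + 2 * b + 13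
        + 6 * (2 * (2 * A) * B) + 6 * (B * (2 * C))) ≡
    36 * (2 * (2 * A) * B * (2 * C)) + B + 6 * (2 * (2 * A)) + 6 * (2 * C)
      + (4 * a + 4 * c + 2 * (2 + b) + 13
        + 6 * (A * (3 * (3 * B))) + 6 * (3 * (3 * B) * C))
      + suc (31 + 360 * p + 264 * r + 324 * (p * r)
        + q * (8 + 42 * p + 30 * r + 36 * (p * r)))
  identity = solve-∀

  exchange : ∀ a b c A B C {x y} → 2 ≤ A → 9 ≤ B → 2 ≤ C →
    4 * x + (4 * (2 + a) + 4 * (1 + c) + 2 * b + 13
      + 6 * (2 * (2 * A) * B) + 6 * (B * (2 * C))) ≡
      36 * (2 * (2 * A) * B * (2 * C)) + B + 6 * (2 * (2 * A)) + 6 * (2 * C) →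
    4 * y + (4 * a + 4 * c + 2 * (2 + b) + 13
      + 6 * (A * (3 * (3 * B))) + 6 * (3 * (3 * B) * C)) ≡
      36 * (A * (3 * (3 * B)) * C) + 3 * (3 * B) + 6 * A + 6 * C →
    x < y
  exchange a b c A B C 2≤A 9≤B 2≤C x-eq y-eq
    with m≤n⇒∃[o]m+o≡n 2≤A | m≤n⇒∃[o]m+o≡n 9≤B | m≤n⇒∃[o]m+o≡n 2≤C
  ... | p , refl | q , refl | r , refl = excess⇒< _ x-eq y-eq (identity a b c p q r)

-- Optimal profiles

sum-replicate : ∀ n m → sum (replicate n m) ≡ n * m
sum-replicate zero    m = refl
sum-replicate (suc n) m = cong (m +_) (sum-replicate n m)

sum-profile : ∀ a b c → sum (profile a b c) ≡ 2 * a + 3 * b + 2 * c + 2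
sum-profile a b c
  rewrite sum-++ (replicate a 2) (replicate b 3 ++ replicate c 2 ++ replicate 1 1)
        | sum-++ (replicate b 3) (replicate c 2 ++ replicate 1 1)
        | sum-++ (replicate c 2) (replicate 1 1)
        | sum-replicate a 2 | sum-replicate b 3 | sum-replicate c 2 =
  identity a b c
  where
  identity : ∀ a b c → 1 + (a * 2 + (b * 3 + (c * 2 + 1))) ≡ 2 * a + 3 * b + 2 * c + 2
  identity = solve-∀

All-profile : ∀ {Q : ℕ → Set} → Q 1 → Q 2 → Q 3 → ∀ a b c → All Q (profile a b c)
All-profile q₁ q₂ q₃ a b c =
  q₁ ∷ ++⁺ (replicate⁺ a q₂) (++⁺ (replicate⁺ b q₃) (++⁺ (replicate⁺ c q₂) (q₁ ∷ [])))

profileGraph : ∀ {N} a b c → 2 * a + 3 * b + 2 * c + 2 ≡ N → TrunkGraph N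
profileGraph a b c eq = record
  { multiplicities = profile a b c
  ; 2≤#vertices    = s≤s (s≤s z≤n)
  ; positive       = All-profile (s≤s z≤n) (s≤s z≤n) (s≤s z≤n) a b c
  ; #edges≡N       = trans (sum-profile a b c) eq
  }

profileGraph-𝒯₃ : ∀ {N} a b c (eq : 2 * a + 3 * b + 2 * c + 2 ≡ N) →
  𝒯₃ N (profileGraph a b c eq)
profileGraph-𝒯₃ a b c _ =
  All-profile (s≤s z≤n) (s≤s (s≤s z≤n)) (s≤s (s≤s (s≤s z≤n))) a b c

-- Only profiles with equally many edges compete: both exchanges stay in this family, and so does
-- swapping the blocks of twos.
IsOptimal : ℕ → ℕ → ℕ → Set
IsOptimal a b c = ∀ a′ b′ c′ →
  2 * a′ + 3 * b′ + 2 * c′ + 2 ≡ 2 * a + 3 * b + 2 * c + 2 →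
  #paths (profile a′ b′ c′) ≤ #paths (profile a b c)

weight-comm : ∀ a b c → 2 * a + 3 * b + 2 * c + 2 ≡ 2 * c + 3 * b + 2 * a + 2
weight-comm = solve-∀

IsOptimal-comm : ∀ a b c → IsOptimal a b c → IsOptimal c b a
IsOptimal-comm a b c optimal a′ b′ c′ eq =
  subst (#paths (profile a′ b′ c′) ≤_) (#paths-profile-comm a b c)
    (optimal a′ b′ c′ (trans eq (weight-comm c b a)))

IsOptimal⇒≤2 : ∀ a b c → 1 < b → IsOptimal a b c → a ≤ 2
IsOptimal⇒≤2 0 _ _ _ _ = z≤n
IsOptimal⇒≤2 1 _ _ _ _ = s≤s z≤n
IsOptimal⇒≤2 2 _ _ _ _ = ≤-refl
-- After the trade both blocks of twos are still nonempty, as the bounds 2 ≤ A and 2 ≤ C require.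
IsOptimal⇒≤2 (suc (suc (suc a))) b (suc (suc c)) 1<b optimal =
  contradiction (optimal (1 + a) (2 + b) (1 + c) (weight-eq a b c))
    (<⇒≱ (trading-increases-#paths (1 + a) b (1 + c) (s≤s z≤n) 1<b (s≤s z≤n)))
  where
  weight-eq : ∀ a b c →
    2 * (1 + a) + 3 * (2 + b) + 2 * (1 + c) + 2 ≡ 2 * (3 + a) + 3 * b + 2 * (2 + c) + 2
  weight-eq = solve-∀
-- For c ≤ 1 a trade would need a two that is absent or use up the only one on the right, so a two
-- is moved there instead.
IsOptimal⇒≤2 (suc (suc (suc a))) b c@0 1<b optimal =
  contradiction (optimal (2 + a) b 1 (weight-eq a b))
    (<⇒≱ (balancing-increases-#paths (2 + a) b c (s≤s z≤n) (<⇒≤ 1<b)))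
  where
  weight-eq : ∀ a b → 2 * (2 + a) + 3 * b + 2 * 1 + 2 ≡ 2 * (3 + a) + 3 * b + 2 * 0 + 2
  weight-eq = solve-∀
IsOptimal⇒≤2 (suc (suc (suc a))) b c@1 1<b optimal =
  contradiction (optimal (2 + a) b 2 (weight-eq a b))
    (<⇒≱ (balancing-increases-#paths (2 + a) b c (s≤s (s≤s z≤n)) (<⇒≤ 1<b)))
  where
  weight-eq : ∀ a b → 2 * (2 + a) + 3 * b + 2 * 2 + 2 ≡ 2 * (3 + a) + 3 * b + 2 * 1 + 2
  weight-eq = solve-∀

theorem3p13 : (N : ℕ) → N > 0 → (F : TrunkGraph N) → 𝒯₃ N F →
    IsSupremum (𝒯₃ N) P (P F) →
    (n₂ n₃ n₄ : ℕ) → HasAssociatedSequence F 1 n₂ n₃ n₄ 1 → n₃ > 1 →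
    n₂ ⊔ n₄ ≤ 2
theorem3p13 N _ F _ (upperBound , _) n₂ n₃ n₄ F-profile n₃>1 =
  ⊔-lub (IsOptimal⇒≤2 n₂ n₃ n₄ n₃>1 optimal)
    (IsOptimal⇒≤2 n₄ n₃ n₂ n₃>1 (IsOptimal-comm n₂ n₃ n₄ optimal))
  where
  F-weight : 2 * n₂ + 3 * n₃ + 2 * n₄ + 2 ≡ N
  F-weight = trans (sym (trans (cong sum F-profile) (sum-profile n₂ n₃ n₄))) (#edges≡N F)

  optimal : IsOptimal n₂ n₃ n₄
  optimal a b c eq =
    -- Each competing profile is realised by a graph in `𝒯₃ N`, to which the upper bound `P F`
    -- applies.
    subst (#paths (profile a b c) ≤_) (cong #paths F-profile)
      (upperBound (profileGraph a b c (trans eq F-weight))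
        (profileGraph-𝒯₃ a b c (trans eq F-weight)))
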